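{- For every $A\in 2^\omega$, no higher $A$-c.e. set $X\subseteq\omega$ (identified with its characteristic sequence in $2^\omega$) is higher $A$-Kurtz random.
   Context: For $A\in 2^\omega$ and a countable set $D$ ($D=\omega$ or $D=2^{<\omega}$), and $W\subseteq 2^{<\omega}\times D$, let $W^A=\{d\in D : (\exists \tau\prec A)\ (\tau,d)\in W\}$, where $\tau\prec A$ means that $\tau$ is a finite initial segment of $A$. A subset of $D$ is higher $A$-c.e. if it equals $W^A$ for some $\Pi^1_1$ (lightface, no oracle) set $W\subseteq 2^{<\omega}\times D$. For $V\subseteq 2^{<\omega}$ let $[V]^\prec=\{X\in 2^\omega : (\exists\sigma\prec X)\ \sigma\in V\}$. A subset of $2^\omega$ is higher $A$-c.e. open if it is $[V]^\prec$ for some higher $A$-c.e. set $V\subseteq 2^{<\omega}$; it is higher $A$-effectively closed if its complement is higher $A$-c.e. open. A sequence in $2^\omega$ is higher $A$-Kurtz random if it is an element of no higher $A$-effectively closed set of measure zero (with respect to the fair-coin measure on $2^\omega$). -}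

module Defs where

open import Data.Bool.Base using (Bool; true; false; if_then_else_)
open import Data.Fin.Base using (Fin)
open import Data.List.Base using (List; []; _∷_; length; applyUpTo; foldl; foldr; map)
open import Data.Maybe.Base using (Maybe; just; maybe′)
open import Data.Nat.Base using (ℕ; suc; _+_; _*_; _<_)
open import Data.Product.Base using (Σ-syntax; ∃; ∃-syntax; _×_; _,_)
open import Data.Rational.Base as ℚ using (ℚ; 0ℚ; 1ℚ; ½)
open import Data.Sum.Base using (_⊎_)
open import Data.Vec.Base using (Vec; []; _∷_; lookup)
open import Level using (0ℓ) renaming (suc to lsuc)
open import Relation.Binary.PropositionalEquality.Core using (_≡_)
open import Relation.Nullary.Negation.Core using (¬_)
open import Relation.Unary using (Pred; _∈_; _≐_; ∁)

Cantor : Set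
Cantor = ℕ → Bool

Str : Set
Str = List Bool

infix 4 _≺_

_≺_ : Str → Cantor → Set
σ ≺ X = applyUpTo X (length σ) ≡ σ

-- μ-recursive functions relative to an oracle in Baire space.  `oracle` is
-- the unary function supplied by the oracle.
data Rec : ℕ → Set where
  zeroᶠ  : Rec 0
  sucᶠ   : Rec 1
  oracle : Rec 1
  proj   : ∀ {n} → Fin n → Rec n
  comp   : ∀ {m n} → Rec m → Vec (Rec n) m → Rec n
  prec   : ∀ {n} → Rec n → Rec (2 + n) → Rec (1 + n)
  μ      : ∀ {n} → Rec (1 + n) → Rec n

-- Eval f e xs y : the computation of e with oracle f on input xs halts with
-- value y.  In `prec g h` the recursion variable is the first argument, and h
-- receives the recursion variable, the previous value and the parameters.
data Eval (f : ℕ → ℕ) : ∀ {n} → Rec n → Vec ℕ n → ℕ → Set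
data Evals (f : ℕ → ℕ) {n} (xs : Vec ℕ n) : ∀ {m} → Vec (Rec n) m → Vec ℕ m → Set

data Eval f where
  ev-zero   : Eval f zeroᶠ [] 0
  ev-suc    : ∀ {x} → Eval f sucᶠ (x ∷ []) (suc x)
  ev-oracle : ∀ {x} → Eval f oracle (x ∷ []) (f x)
  ev-proj   : ∀ {n} {i : Fin n} {xs} → Eval f (proj i) xs (lookup xs i)
  ev-comp   : ∀ {m n} {h : Rec m} {gs : Vec (Rec n) m} {xs ys z} →
              Evals f xs gs ys → Eval f h ys z → Eval f (comp h gs) xs z
  ev-prec-0 : ∀ {n} {g : Rec n} {h : Rec (2 + n)} {xs z} →
              Eval f g xs z → Eval f (prec g h) (0 ∷ xs) z
  ev-prec-s : ∀ {n} {g : Rec n} {h : Rec (2 + n)} {x xs y z} →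
              Eval f (prec g h) (x ∷ xs) y → Eval f h (x ∷ y ∷ xs) z →
              Eval f (prec g h) (suc x ∷ xs) z
  ev-μ      : ∀ {n} {g : Rec (1 + n)} {xs y} →
              Eval f g (y ∷ xs) 0 →
              (∀ i → i < y → ∃[ k ] Eval f g (i ∷ xs) (suc k)) →
              Eval f (μ g) xs y

data Evals f xs where
  []  : Evals f xs [] []
  _∷_ : ∀ {m} {g : Rec _} {gs : Vec (Rec _) m} {y ys} →
        Eval f g xs y → Evals f xs gs ys → Evals f xs (g ∷ gs) (y ∷ ys)

-- R ⊆ ω^ω × ω^n is computable when its characteristic function is computed,
-- uniformly in the oracle, by a single program.
Computable : ∀ {n} → ((ℕ → ℕ) → Vec ℕ n → Set) → Set
Computable {n} R = Σ[ e ∈ Rec n ] ∀ f xs →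
  (R f xs × Eval f e xs 1) ⊎ (¬ R f xs × Eval f e xs 0)

-- The number with binary numeral 1σ.
⌜_⌝ : Str → ℕ
⌜ σ ⌝ = foldl (λ c b → 2 * c + (if b then 1 else 0)) 1 σ

-- Lightface Π¹₁ in Kleene normal form, ∀f ∃y R with R computable.  The
-- coding `enc` of D is the identity for D = ω and ⌜_⌝ for D = 2^{<ω}.
Π¹₁ : {D : Set} → (D → ℕ) → Pred (Str × D) 0ℓ → Set₁
Π¹₁ enc W = Σ[ R ∈ ((ℕ → ℕ) → Vec ℕ 3 → Set) ]
  (Computable R ×
   W ≐ λ (τ , d) → ∀ f → ∃[ y ] R f (⌜ τ ⌝ ∷ enc d ∷ y ∷ []))

_^[_] : {D : Set} → Pred (Str × D) 0ℓ → Cantor → Pred D 0ℓ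
(W ^[ A ]) d = ∃[ τ ] (τ ≺ A × (τ , d) ∈ W)

HigherCE : {D : Set} → (D → ℕ) → Cantor → Pred D 0ℓ → Set₁
HigherCE enc A S = ∃[ W ] (Π¹₁ enc W × S ≐ W ^[ A ])

HigherCEω : Cantor → Pred ℕ 0ℓ → Set₁
HigherCEω = HigherCE (λ n → n)

HigherCEStr : Cantor → Pred Str 0ℓ → Set₁
HigherCEStr = HigherCE ⌜_⌝

[_]≺ : Pred Str 0ℓ → Pred Cantor 0ℓ
[ V ]≺ X = ∃[ σ ] (σ ≺ X × σ ∈ V)

HigherCEOpen : Cantor → Pred Cantor 0ℓ → Set₁
HigherCEOpen A U = ∃[ V ] (HigherCEStr A V × U ≐ [ V ]≺)

HigherEffClosed : Cantor → Pred Cantor 0ℓ → Set₁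
HigherEffClosed A P = HigherCEOpen A (∁ P)

-- The fair-coin measure 2^{-|σ|} of the cylinder of σ.
weight : Str → ℚ
weight []      = 1ℚ
weight (_ ∷ σ) = ½ ℚ.* weight σ

-- Measure zero, as vanishing of the outer measure: for every ε > 0 there is a
-- countable cover by cylinders of total measure at most ε (a series of
-- nonnegative terms, hence bounded by ε iff all its partial sums are).  An
-- entry `nothing` of the sequence is the empty set.
Null : Pred Cantor 0ℓ → Set
Null P = ∀ (ε : ℚ) → 0ℚ ℚ.< ε → Σ[ c ∈ (ℕ → Maybe Str) ]
  ((∀ X → X ∈ P → ∃[ i ] ∃[ σ ] (c i ≡ just σ × σ ≺ X)) ×
   (∀ n → foldr ℚ._+_ 0ℚ (map (maybe′ weight 0ℚ) (applyUpTo c n)) ℚ.≤ ε))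

HigherKurtzRandom : Cantor → Pred Cantor (lsuc 0ℓ)
HigherKurtzRandom A X = ∀ P → HigherEffClosed A P → Null P → ¬ X ∈ P

-- The subset of ω whose characteristic sequence is X.
set : Cantor → Pred ℕ 0ℓ
set X n = X n ≡ true

{-# OPTIONS --safe #-}

-- If X is infinite, it lies in the class of all Y ⊇ X, which is null; and Y
-- leaves this class as soon as it has an initial segment ρ0 with |ρ| ∈ X, which
-- is a higher A-c.e. event because X is higher A-c.e.  If X is finite, with all
-- elements below N, it lies in the null class of all Y with Y(n) = 0 for n ≥ N.
-- Both are instances of the class of all Y that are constant on an unbounded
-- higher A-c.e. set.
module Submission where

open import Defs
open import Axiom.ExcludedMiddle using (ExcludedMiddle)
open import Level using (0ℓ)
open import Relation.Nullary.Negation.Core using (¬_)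

open import Data.Bool.Base using (Bool; true; false; not; if_then_else_)
open import Data.Bool.Properties using (¬-not; not-¬) renaming (_≟_ to _≟ᵇ_)
open import Data.Empty using (⊥; ⊥-elim)
open import Data.Fin.Patterns using (0F; 1F; 2F; 3F)
open import Data.Integer.Base as ℤ using (+_; +[1+_]; -[1+_])
import Data.Integer.Properties as ℤ
open import Data.List.Base using (List; []; _∷_; _++_; length; applyUpTo; foldr; map)
open import Data.List.Properties using (applyUpTo-∷ʳ; foldl-∷ʳ; length-applyUpTo)
open import Data.List.Relation.Unary.Any as Any using (Any; here; there)
import Data.List.Relation.Unary.Any.Properties as Any
open import Data.Maybe.Base using (Maybe; just; nothing; maybe′)
open import Data.Nat.Base
open import Data.Nat.Properties
open import Data.Product.Base using (Σ-syntax; ∃-syntax; _×_; _,_; proj₁; proj₂)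
open import Data.Rational.Base as ℚ using (ℚ; mkℚ; 0ℚ; 1ℚ; ½; toℚᵘ)
import Data.Rational.Properties as ℚ
open import Data.Rational.Unnormalised.Base as ℚᵘ using (mkℚᵘ)
import Data.Rational.Unnormalised.Properties as ℚᵘ
open import Data.Sum.Base using (_⊎_; inj₁; inj₂)
open import Data.Vec.Base using (Vec; []; _∷_; lookup)
open import Function.Base using (id; _∘_)
open import Relation.Binary.PropositionalEquality
open import Relation.Nullary.Decidable.Core using (yes; no; decidable-stable)
open import Relation.Unary using (Pred; _∈_)

-- Programs for arithmetic and the binary logarithm.

const : ∀ {n} → ℕ → Rec n
const zero    = comp zeroᶠ []
const (suc k) = comp sucᶠ (const k ∷ [])

const-eval : ∀ {f n} {xs : Vec ℕ n} k → Eval f (const k) xs k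
const-eval zero    = ev-comp [] ev-zero
const-eval (suc k) = ev-comp (const-eval k ∷ []) ev-suc

add : Rec 2
add = prec (proj 0F) (comp sucᶠ (proj 1F ∷ []))

add-eval : ∀ {f} x y → Eval f add (x ∷ y ∷ []) (x + y)
add-eval zero    y = ev-prec-0 ev-proj
add-eval (suc x) y = ev-prec-s (add-eval x y) (ev-comp (ev-proj ∷ []) ev-suc)

multiply : Rec 2
multiply = prec (const 0) (comp add (proj 2F ∷ proj 1F ∷ []))

multiply-eval : ∀ {f} x y → Eval f multiply (x ∷ y ∷ []) (x * y)
multiply-eval zero    y = ev-prec-0 (const-eval 0)
multiply-eval (suc x) y =
  ev-prec-s (multiply-eval x y) (ev-comp (ev-proj ∷ ev-proj ∷ []) (add-eval y _))

predecessor : Rec 1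
predecessor = prec zeroᶠ (proj 0F)

predecessor-eval : ∀ {f} x → Eval f predecessor (x ∷ []) (pred x)
predecessor-eval zero    = ev-prec-0 ev-zero
predecessor-eval (suc x) = ev-prec-s (predecessor-eval x) ev-proj

-- The recursion is on the subtrahend, which therefore comes first.
monus : Rec 2
monus = prec (proj 0F) (comp predecessor (proj 1F ∷ []))

monus-eval : ∀ {f} y x → Eval f monus (y ∷ x ∷ []) (x ∸ y)
monus-eval zero    x = ev-prec-0 ev-proj
monus-eval (suc y) x = subst (Eval _ _ _) (pred[m∸n]≡m∸[1+n] x y)
  (ev-prec-s (monus-eval y x) (ev-comp (ev-proj ∷ []) (predecessor-eval _)))

power : Rec 1
power = prec (const 1) (comp multiply (const 2 ∷ proj 1F ∷ []))

power-eval : ∀ {f} x → Eval f power (x ∷ []) (2 ^ x)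
power-eval zero    = ev-prec-0 (const-eval 1)
power-eval (suc x) =
  ev-prec-s (power-eval x) (ev-comp (const-eval 2 ∷ ev-proj ∷ []) (multiply-eval 2 _))

leq : Rec 2
leq = comp monus (comp monus (proj 1F ∷ proj 0F ∷ []) ∷ const 1 ∷ [])

leq-eval : ∀ {f} x y → Eval f leq (x ∷ y ∷ []) (1 ∸ (x ∸ y))
leq-eval x y = ev-comp
  (ev-comp (ev-proj ∷ ev-proj ∷ []) (monus-eval y x) ∷ const-eval 1 ∷ [])
  (monus-eval (x ∸ y) 1)

-- The binary logarithm, with log 0 = 0; the increment is 1 exactly when the next
-- power of two is reached, since 1 ∸ (m ∸ n) is 1 if m ≤ n and 0 otherwise.
log : ℕ → ℕ
log zero    = 0
log (suc s) = log s + (1 ∸ (2 ^ suc (log s) ∸ suc s))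

logarithm : Rec 1
logarithm = prec (const 0) (comp add (proj 1F ∷ comp leq
  (comp power (comp sucᶠ (proj 1F ∷ []) ∷ []) ∷ comp sucᶠ (proj 0F ∷ []) ∷ []) ∷ []))

logarithm-eval : ∀ {f} s → Eval f logarithm (s ∷ []) (log s)
logarithm-eval zero    = ev-prec-0 (const-eval 0)
logarithm-eval (suc s) = ev-prec-s (logarithm-eval s) (ev-comp
  (ev-proj ∷
   ev-comp (ev-comp (ev-comp (ev-proj ∷ []) ev-suc ∷ []) (power-eval (suc (log s))) ∷
            ev-comp (ev-proj ∷ []) ev-suc ∷ [])
           (leq-eval (2 ^ suc (log s)) (suc s)) ∷ [])
  (add-eval (log s) _))

-- Induction: an argument that reaches the next power of two exceeds its predecessor by one only, so
-- it stays below the double of that power; otherwise the exponent persists.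
log-bounds : ∀ s → 2 ^ log (suc s) ≤ suc s × suc s < 2 ^ suc (log (suc s))
log-bounds zero    = ≤-refl , ≤-refl
log-bounds (suc s) with log-bounds s
... | lower , upper with 2 ^ suc (log (suc s)) ≤? suc (suc s)
... | yes p rewrite m≤n⇒m∸n≡0 p | +-comm (log (suc s)) 1 =
  p , <-≤-trans (s≤s upper) (≤-trans (+-monoˡ-≤ (2 ^ suc l) (m^n>0 2 (suc l)))
        (+-monoʳ-≤ (2 ^ suc l) (m≤m+n (2 ^ suc l) 0)))
  where l = log (suc s)
... | no ¬p with m<n⇒0<n∸m (≰⇒> ¬p)
... | d>0 rewrite m≤n⇒m∸n≡0 d>0 | +-identityʳ (log (suc s)) = m≤n⇒m≤1+n lower , ≰⇒> ¬p

2^-reflects-≤ : ∀ {m n s} → 2 ^ m ≤ s → s < 2 ^ suc n → m ≤ n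
2^-reflects-≤ p q = ≮⇒≥ λ n<m → <⇒≱ q (≤-trans (^-monoʳ-≤ 2 n<m) p)

-- The intervals from `2 ^ m` to `2 ^ suc m`, right end excluded, are disjoint for distinct `m`.
log-unique : ∀ {m s} → 2 ^ m ≤ s → s < 2 ^ suc m → log s ≡ m
log-unique {m} {zero}  p q = ⊥-elim (<⇒≱ (m^n>0 2 m) p)
log-unique {m} {suc s} p q with log-bounds s
... | lower , upper = ≤-antisym (2^-reflects-≤ lower q) (2^-reflects-≤ p upper)

-- Length and last bit of a string, read off its code.

bit : Bool → ℕ
bit b = if b then 1 else 0

-- `true` stands for odd and `false` for even, so this tests whether a binary numeral ends in `b`.
hasParity : Bool → ℕ → ℕ
hasParity b zero    = bit (not b)
hasParity b (suc n) = 1 ∸ hasParity b n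

parityOf : Bool → Rec 1
parityOf b = prec (const (bit (not b))) (comp monus (proj 1F ∷ const 1 ∷ []))

parityOf-eval : ∀ {f} b n → Eval f (parityOf b) (n ∷ []) (hasParity b n)
parityOf-eval b zero    = ev-prec-0 (const-eval _)
parityOf-eval b (suc n) = ev-prec-s (parityOf-eval b n)
  (ev-comp (ev-proj ∷ const-eval 1 ∷ []) (monus-eval (hasParity b n) 1))

hasParity≤1 : ∀ b n → hasParity b n ≤ 1
hasParity≤1 true  zero    = z≤n
hasParity≤1 false zero    = ≤-refl
hasParity≤1 b     (suc n) = m∸n≤m 1 (hasParity b n)

-- Two flips cancel: the value is at most 1, so truncated subtraction from 1 is an involution on it.
hasParity-2* : ∀ b c x → hasParity b (2 * c + x) ≡ hasParity b x
hasParity-2* b zero    x = refl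
hasParity-2* b (suc c) x rewrite +-suc c (c + 0) =
  trans (m∸[m∸n]≡n (hasParity≤1 b (2 * c + x))) (hasParity-2* b c x)

hasParity-bit : ∀ b → hasParity b (bit b) ≡ 1
hasParity-bit true  = refl
hasParity-bit false = refl

hasParity-bit-not : ∀ b → hasParity b (bit (not b)) ≡ 0
hasParity-bit-not true  = refl
hasParity-bit-not false = refl

⌜applyUpTo⌝-suc : ∀ Y n → ⌜ applyUpTo Y (suc n) ⌝ ≡ 2 * ⌜ applyUpTo Y n ⌝ + bit (Y n)
⌜applyUpTo⌝-suc Y n = trans (cong ⌜_⌝ (sym (applyUpTo-∷ʳ Y n))) (foldl-∷ʳ _ 1 (Y n) (applyUpTo Y n))

bit≤1 : ∀ b → bit b ≤ 1
bit≤1 true  = ≤-refl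
bit≤1 false = z≤n

-- The leading 1 gives the numeral exactly `suc n` binary digits, whatever the bits of `Y`.
⌜applyUpTo⌝-bounds : ∀ Y n → 2 ^ n ≤ ⌜ applyUpTo Y n ⌝ × ⌜ applyUpTo Y n ⌝ < 2 ^ suc n
⌜applyUpTo⌝-bounds Y zero    = ≤-refl , ≤-refl
⌜applyUpTo⌝-bounds Y (suc n) rewrite ⌜applyUpTo⌝-suc Y n with ⌜applyUpTo⌝-bounds Y n
... | lower , upper =
  ≤-trans (*-monoʳ-≤ 2 lower) (m≤m+n _ _) ,
  (begin-strict
    2 * c + bit (Y n) ≤⟨ +-monoʳ-≤ (2 * c) (bit≤1 (Y n)) ⟩
    2 * c + 1         <⟨ +-monoʳ-< (2 * c) ≤-refl ⟩
    2 * c + 2         ≡⟨ +-comm (2 * c) 2 ⟩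
    2 + 2 * c         ≡⟨ *-suc 2 c ⟨
    2 * suc c         ≤⟨ *-monoʳ-≤ 2 upper ⟩
    2 ^ suc (suc n)   ∎)
  where
  open ≤-Reasoning
  c = ⌜ applyUpTo Y n ⌝

log-⌜applyUpTo⌝ : ∀ Y n → log ⌜ applyUpTo Y n ⌝ ≡ n
log-⌜applyUpTo⌝ Y n = log-unique (proj₁ (⌜applyUpTo⌝-bounds Y n)) (proj₂ (⌜applyUpTo⌝-bounds Y n))

-- On the code of σ this is |σ| if σ ends in b, and 0 otherwise.
lengthIfEndsIn : Bool → ℕ → ℕ
lengthIfEndsIn b s = log s * hasParity b s

endLength : Bool → Rec 1
endLength b = comp multiply (logarithm ∷ parityOf b ∷ [])

endLength-eval : ∀ {f} b s → Eval f (endLength b) (s ∷ []) (lengthIfEndsIn b s)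
endLength-eval b s =
  ev-comp (logarithm-eval s ∷ parityOf-eval b s ∷ []) (multiply-eval (log s) _)

lengthIfEndsIn-suc : ∀ b Y n →
  lengthIfEndsIn b ⌜ applyUpTo Y (suc n) ⌝ ≡ suc n * hasParity b (bit (Y n))
lengthIfEndsIn-suc b Y n = cong₂ _*_ (log-⌜applyUpTo⌝ Y (suc n))
  (trans (cong (hasParity b) (⌜applyUpTo⌝-suc Y n)) (hasParity-2* b ⌜ applyUpTo Y n ⌝ (bit (Y n))))

lengthIfEndsIn-complete : ∀ b Y n → Y n ≡ b → lengthIfEndsIn b ⌜ applyUpTo Y (suc n) ⌝ ≡ suc n
lengthIfEndsIn-complete b Y n refl =
  trans (lengthIfEndsIn-suc b Y n)
    (trans (cong (suc n *_) (hasParity-bit b)) (*-identityʳ (suc n)))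

-- A positive value rules out the empty string and a wrong last bit; it is then the length, one more
-- than the last position.
lengthIfEndsIn-sound : ∀ b Y m {n} → lengthIfEndsIn b ⌜ applyUpTo Y m ⌝ ≡ suc n → Y n ≡ b
lengthIfEndsIn-sound b Y (suc m) {n} eq with Y m ≟ᵇ b
... | yes Ym≡b = subst (λ k → Y k ≡ b)
  (suc-injective (trans (sym (lengthIfEndsIn-complete b Y m Ym≡b)) eq)) Ym≡b
... | no Ym≢b with trans (sym eq) (trans (lengthIfEndsIn-suc b Y m)
        (trans (cong (λ a → suc m * hasParity b (bit a)) (¬-not Ym≢b))
          (trans (cong (suc m *_) (hasParity-bit-not b)) (*-zeroʳ (suc m)))))
... | ()

-- The computable kernel of the higher c.e. open complement.

module _ (R : (ℕ → ℕ) → Vec ℕ 3 → Set) where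

  -- A string of length `suc n` has its last bit at position `n`. The value 0 marks strings without
  -- the wanted last bit, and these are excluded.
  AtPredecessor : (ℕ → ℕ) → ℕ → ℕ → ℕ → Set
  AtPredecessor f zero    t y = ⊥
  AtPredecessor f (suc n) t y = R f (t ∷ n ∷ y ∷ [])

  -- If `R` is a kernel of `W`, this is a kernel of the set of all (τ, σ) such that σ ends in `b` at
  -- some position n with (τ, n) in `W`.
  LastBit : Bool → (ℕ → ℕ) → Vec ℕ 3 → Set
  LastBit b f (t ∷ s ∷ y ∷ []) = AtPredecessor f (lengthIfEndsIn b s) t y

  module _ (R-computable : Computable R) where

    -- Primitive recursion serves as a case distinction: the previous value is never read.
    atPredecessor : Rec 3
    atPredecessor = prec (const 0) (comp (proj₁ R-computable) (proj 2F ∷ proj 0F ∷ proj 3F ∷ []))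

    atPredecessor-decides : ∀ f k t y →
      (AtPredecessor f k t y × Eval f atPredecessor (k ∷ t ∷ y ∷ []) 1) ⊎
      (¬ AtPredecessor f k t y × Eval f atPredecessor (k ∷ t ∷ y ∷ []) 0)
    -- `ev-prec-s` demands an evaluation at `n` even though its value is discarded.
    atPredecessor-halts : ∀ f k t y → ∃[ v ] Eval f atPredecessor (k ∷ t ∷ y ∷ []) v

    atPredecessor-decides f zero    t y = inj₂ ((λ ()) , ev-prec-0 (const-eval 0))
    atPredecessor-decides f (suc n) t y
      with atPredecessor-halts f n t y | proj₂ R-computable f (t ∷ n ∷ y ∷ [])
    ... | _ , ev | inj₁ (r , ev₁)  =
      inj₁ (r , ev-prec-s ev (ev-comp (ev-proj ∷ ev-proj ∷ ev-proj ∷ []) ev₁))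
    ... | _ , ev | inj₂ (¬r , ev₀) =
      inj₂ (¬r , ev-prec-s ev (ev-comp (ev-proj ∷ ev-proj ∷ ev-proj ∷ []) ev₀))

    atPredecessor-halts f k t y with atPredecessor-decides f k t y
    ... | inj₁ (_ , ev) = 1 , ev
    ... | inj₂ (_ , ev) = 0 , ev

    LastBit-computable : ∀ b → Computable (LastBit b)
    LastBit-computable b =
      comp atPredecessor (comp (endLength b) (proj 1F ∷ []) ∷ proj 0F ∷ proj 2F ∷ []) , decides
      where
      arguments : ∀ {f} t s y → Evals f (t ∷ s ∷ y ∷ [])
        (comp (endLength b) (proj 1F ∷ []) ∷ proj 0F ∷ proj 2F ∷ []) (lengthIfEndsIn b s ∷ t ∷ y ∷ [])
      arguments t s y = ev-comp (ev-proj ∷ []) (endLength-eval b s) ∷ ev-proj ∷ ev-proj ∷ []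

      decides : ∀ f xs → _
      decides f (t ∷ s ∷ y ∷ []) with atPredecessor-decides f (lengthIfEndsIn b s) t y
      ... | inj₁ (r , ev)  = inj₁ (r , ev-comp (arguments t s y) ev)
      ... | inj₂ (¬r , ev) = inj₂ (¬r , ev-comp (arguments t s y) ev)

-- Effective closedness of the class.

ConstantOn : Pred ℕ 0ℓ → Bool → Pred Cantor 0ℓ
ConstantOn S c Y = ∀ n → n ∈ S → Y n ≡ c

¬∀⟶∃¬ : ExcludedMiddle 0ℓ → {A : Set} {P : Pred A 0ℓ} → ¬ (∀ x → P x) → ∃[ x ] ¬ P x
¬∀⟶∃¬ em ¬∀ with em
... | yes ∃¬ = ∃¬
... | no ¬∃¬ = ⊥-elim (¬∀ λ x → decidable-stable em λ ¬p → ¬∃¬ (x , ¬p))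

-- A sequence leaves the class exactly when some initial segment ends in `b` at a position in `S`;
-- the τ that enumerates the position into `S` also enumerates the segment.
ConstantOn-higherEffClosed : ExcludedMiddle 0ℓ → ∀ {A S} b →
  HigherCEω A S → HigherEffClosed A (ConstantOn S (not b))
ConstantOn-higherEffClosed em {A} {S} b (W , (R , R-computable , W⇒R , R⇒W) , S⇒W , W⇒S) =
  V ^[ A ] ,
  (V , (LastBit R b , LastBit-computable R R-computable b , id , id) , id , id) ,
  leaves , left
  where
  V : Pred (Str × Str) 0ℓ
  V (τ , σ) = ∀ f → ∃[ y ] LastBit R b f (⌜ τ ⌝ ∷ ⌜ σ ⌝ ∷ y ∷ [])

  leaves : ∀ {Y} → ¬ ConstantOn S (not b) Y → [ V ^[ A ] ]≺ Y
  leaves {Y} ¬constant with ¬∀⟶∃¬ em ¬constant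
  ... | n , ¬Yn with em {n ∈ S}
  ... | no n∉S = ⊥-elim (¬Yn λ n∈S → ⊥-elim (n∉S n∈S))
  ... | yes n∈S with S⇒W n∈S
  ... | τ , τ≺A , τn∈W =
    -- Length `suc n` makes `n` the last position.
    applyUpTo Y (suc n) , cong (applyUpTo Y) (length-applyUpTo Y (suc n)) , τ , τ≺A , inV
    where
    Yn≡b : Y n ≡ b
    Yn≡b = decidable-stable (Y n ≟ᵇ b) λ Yn≢b → ¬Yn λ _ → ¬-not Yn≢b

    inV : (τ , applyUpTo Y (suc n)) ∈ V
    inV f with W⇒R τn∈W f
    ... | y , r = y , subst (λ k → AtPredecessor R f k ⌜ τ ⌝ y)
                        (sym (lengthIfEndsIn-complete b Y n Yn≡b)) r

  left : ∀ {Y} → [ V ^[ A ] ]≺ Y → ¬ ConstantOn S (not b) Y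
  left {Y} (σ , σ≺Y , τ , τ≺A , τσ∈V) constant
    with lengthIfEndsIn b ⌜ σ ⌝ in eq
  -- The kernel is empty here, so any oracle refutes membership; `id` is an arbitrary choice.
  ... | zero  = proj₂ (τσ∈V id)
  ... | suc n = not-¬ (lengthIfEndsIn-sound b Y (length σ)
                        (trans (cong (λ ρ → lengthIfEndsIn b ⌜ ρ ⌝) σ≺Y) eq))
                  (constant n (W⇒S (τ , τ≺A , R⇒W τσ∈V)))

-- Powers of one half below every positive rational.

½^_ : ℕ → ℚ
½^ zero  = 1ℚ
½^ suc m = ½ ℚ.* ½^ m

-- `mkℚᵘ` stores the denominator minus one. Halving 1/(m+1) gives at most 1/(m+2).
½^m≤1/[1+m] : ∀ m → toℚᵘ (½^ m) ℚᵘ.≤ mkℚᵘ (+ 1) m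
½^m≤1/[1+m] zero    = ℚᵘ.≤-refl
½^m≤1/[1+m] (suc m) = begin
  toℚᵘ (½ ℚ.* ½^ m)            ≃⟨ ℚ.toℚᵘ-homo-* ½ (½^ m) ⟩
  toℚᵘ ½ ℚᵘ.* toℚᵘ (½^ m)      ≤⟨ ℚᵘ.*-monoʳ-≤-nonNeg (toℚᵘ ½) (½^m≤1/[1+m] m) ⟩
  toℚᵘ ½ ℚᵘ.* mkℚᵘ (+ 1) m     ≤⟨ ℚᵘ.*≤* (ℤ.+≤+ (subst₂ _≤_ (sym (+-identityʳ _)) (sym (+-identityʳ _)) 2+m≤2*[1+m])) ⟩
  mkℚᵘ (+ 1) (suc m)           ∎
  where
  open ℚᵘ.≤-Reasoning

  2+m≤2*[1+m] : suc (suc m) ≤ 2 * suc m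
  2+m≤2*[1+m] = +-mono-≤ (s≤s (z≤n {m})) (m≤m+n (suc m) 0)

½^-archimedean : ∀ ε → 0ℚ ℚ.< ε → ∃[ m ] ½^ m ℚ.≤ ε
-- A positive fraction is at least 1 over its denominator `suc d`.
½^-archimedean (mkℚ +[1+ a ] d _) _ = d , ℚ.toℚᵘ-cancel-≤
  (ℚᵘ.≤-trans (½^m≤1/[1+m] d) (ℚᵘ.*≤* (ℤ.*-monoʳ-≤-nonNeg (+ suc d) (ℤ.+≤+ (s≤s (z≤n {a}))))))
½^-archimedean (mkℚ (+ 0)    d _) (ℚ.*<* (ℤ.+<+ ()))
½^-archimedean (mkℚ -[1+ a ] d _) (ℚ.*<* ())

-- Finite covers by cylinders.

total : List Str → ℚ
total l = foldr ℚ._+_ 0ℚ (map weight l)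

total-++ : ∀ k l → total (k ++ l) ≡ total k ℚ.+ total l
total-++ []      l = sym (ℚ.+-identityˡ (total l))
total-++ (σ ∷ k) l = trans (cong (weight σ ℚ.+_) (total-++ k l))
  (sym (ℚ.+-assoc (weight σ) (total k) (total l)))

total-map-∷ : ∀ b l → total (map (b ∷_) l) ≡ ½ ℚ.* total l
total-map-∷ b []      = refl
total-map-∷ b (σ ∷ l) = trans (cong (½ ℚ.* weight σ ℚ.+_) (total-map-∷ b l))
  (sym (ℚ.*-distribˡ-+ ½ (weight σ) (total l)))

weight-nonNeg : ∀ σ → 0ℚ ℚ.≤ weight σ
weight-nonNeg []      = ℚ.nonNegative⁻¹ 1ℚ
weight-nonNeg (_ ∷ σ) = ℚ.*-monoˡ-≤-nonNeg ½ (weight-nonNeg σ)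

Cover : Pred Cantor 0ℓ → ℚ → Set
Cover P w = Σ[ l ∈ List Str ] ((∀ X → X ∈ P → Any (_≺ X) l) × total l ≡ w)

∷-≺ : ∀ X {b σ} → X 0 ≡ b → σ ≺ X ∘ suc → (b ∷ σ) ≺ X
∷-≺ X = cong₂ _∷_

-- The first bit is forced to be `c`, so only one half of the space needs covering.
cover-∷ : ∀ {S c w} → 0 ∈ S → Cover (ConstantOn (S ∘ suc) c) w → Cover (ConstantOn S c) (½ ℚ.* w)
cover-∷ {c = c} 0∈S (l , covers , refl) =
  map (c ∷_) l ,
  (λ X X∈ → Any.map⁺ (Any.map (∷-≺ X (X∈ 0 0∈S)) (covers (X ∘ suc) (X∈ ∘ suc)))) ,
  total-map-∷ c l

½*w+½*w≡w : ∀ w → ½ ℚ.* w ℚ.+ ½ ℚ.* w ≡ w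
½*w+½*w≡w w = trans (sym (ℚ.*-distribʳ-+ w ½ ½)) (ℚ.*-identityˡ w)

-- The first bit may be free, so the cover is copied into both halves, each copy having half the
-- weight.
cover-both : ∀ {S c w} → Cover (ConstantOn (S ∘ suc) c) w → Cover (ConstantOn S c) w
cover-both (l , covers , refl) =
  map (true ∷_) l ++ map (false ∷_) l ,
  (λ X X∈ → split X (X 0) refl (covers (X ∘ suc) (X∈ ∘ suc))) ,
  trans (total-++ (map (true ∷_) l) _)
    (trans (cong₂ ℚ._+_ (total-map-∷ true l) (total-map-∷ false l)) (½*w+½*w≡w (total l)))
  where
  split : ∀ X b → X 0 ≡ b → Any (_≺ X ∘ suc) l → Any (_≺ X) (map (true ∷_) l ++ map (false ∷_) l)
  split X true  X0 = Any.++⁺ˡ ∘ Any.map⁺ ∘ Any.map (∷-≺ X X0)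
  split X false X0 = Any.++⁺ʳ (map (true ∷_) l) ∘ Any.map⁺ ∘ Any.map (∷-≺ X X0)

Unbounded : Pred ℕ 0ℓ → Set
Unbounded S = ∀ p → ∃[ n ] (p ≤ n × n ∈ S)

unbounded-∘suc : ∀ {S} → Unbounded S → Unbounded (S ∘ suc)
unbounded-∘suc unbounded p with unbounded (suc p)
... | suc n , s≤s p≤n , n∈S = n , p≤n , n∈S

-- Both bits are kept up to position `n`, where one is forced. The rest of `S` is still unbounded,
-- which is why the given covers range over all `S`.
cover-halve : ∀ {c w} → (∀ {S} → Unbounded S → Cover (ConstantOn S c) w) →
  ∀ n {S} → n ∈ S → Unbounded S → Cover (ConstantOn S c) (½ ℚ.* w)
cover-halve cover zero    {S} 0∈S unbounded = cover-∷ {S = S} 0∈S (cover (unbounded-∘suc unbounded))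
cover-halve cover (suc n) {S} n∈S unbounded =
  cover-both {S = S} (cover-halve cover n n∈S (unbounded-∘suc unbounded))

cover-½^ : ∀ {c} m {S} → Unbounded S → Cover (ConstantOn S c) (½^ m)
-- The empty string covers the whole space with weight 1.
cover-½^ zero    unbounded = [] ∷ [] , (λ _ _ → here refl) , refl
cover-½^ (suc m) unbounded =
  cover-halve (cover-½^ m) (proj₁ (unbounded 0)) (proj₂ (proj₂ (unbounded 0))) unbounded

-- From finite covers to measure zero.

infix 8 _‼_
_‼_ : {A : Set} → List A → ℕ → Maybe A
[]       ‼ _     = nothing
(x ∷ xs) ‼ zero  = just x
(x ∷ xs) ‼ suc i = xs ‼ i

‼-lookup : ∀ {A : Set} {P : Pred A 0ℓ} {l} → Any P l → ∃[ i ] ∃[ x ] (l ‼ i ≡ just x × P x)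
‼-lookup (here px) = 0 , _ , refl , px
‼-lookup (there p) with ‼-lookup p
... | i , x , eq , px = suc i , x , eq , px

total-nonNeg : ∀ l → 0ℚ ℚ.≤ total l
total-nonNeg []      = ℚ.≤-refl
total-nonNeg (σ ∷ l) = ℚ.+-mono-≤ (weight-nonNeg σ) (total-nonNeg l)

-- Terms past the end of the list add 0, and stopping early drops only nonnegative weights.
partialSum≤total : ∀ l n → foldr ℚ._+_ 0ℚ (map (maybe′ weight 0ℚ) (applyUpTo (l ‼_) n)) ℚ.≤ total l
partialSum≤total l       zero    = total-nonNeg l
partialSum≤total []      (suc n) = ℚ.≤-trans (ℚ.≤-reflexive (ℚ.+-identityˡ _)) (partialSum≤total [] n)
partialSum≤total (σ ∷ l) (suc n) = ℚ.+-monoʳ-≤ (weight σ) (partialSum≤total l n)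

ConstantOn-null : ∀ {S c} → Unbounded S → Null (ConstantOn S c)
ConstantOn-null unbounded ε ε>0 with ½^-archimedean ε ε>0
... | m , ½^m≤ε with cover-½^ m unbounded
... | l , covers , total≡ =
  l ‼_ ,
  (λ X X∈ → ‼-lookup (covers X X∈)) ,
  (λ n → ℚ.≤-trans (partialSum≤total l n) (ℚ.≤-trans (ℚ.≤-reflexive total≡) ½^m≤ε))

-- Final segments of ω, and the two cases of the theorem.

atLeast-computable : ∀ N → Computable {3} (λ _ xs → N ≤ lookup xs 1F)
atLeast-computable N = comp leq (const N ∷ proj 1F ∷ []) , decides
  where
  decides : ∀ f xs → _
  decides f xs with N ≤? lookup xs 1F | ev-comp (const-eval N ∷ ev-proj ∷ []) (leq-eval {f} N (lookup xs 1F))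
  ... | yes N≤n | ev = inj₁ (N≤n , subst (Eval f _ xs) (cong (1 ∸_) (m≤n⇒m∸n≡0 N≤n)) ev)
  ... | no N≰n  | ev = inj₂ (N≰n , subst (Eval f _ xs) (m≤n⇒m∸n≡0 (m<n⇒0<n∸m (≰⇒> N≰n))) ev)

atLeast-higherCE : ∀ A N → HigherCEω A (N ≤_)
atLeast-higherCE A N =
  (λ (_ , n) → N ≤ n) ,
  (_ , atLeast-computable N , (λ N≤n _ → 0 , N≤n) , (λ N≤n → proj₂ (N≤n id))) ,
  -- The empty string is an initial segment of every `A`, and membership does not depend on the
  -- string.
  (λ N≤n → [] , refl , N≤n) , (λ (_ , _ , N≤n) → N≤n)

constantOn⇒¬higherKurtzRandom : ExcludedMiddle 0ℓ → ∀ {A S X} b →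
  HigherCEω A S → Unbounded S → X ∈ ConstantOn S (not b) → ¬ HigherKurtzRandom A X
constantOn⇒¬higherKurtzRandom em b S-ce unbounded X∈ random =
  random _ (ConstantOn-higherEffClosed em b S-ce) (ConstantOn-null unbounded) X∈

theorem5p4 : ExcludedMiddle 0ℓ → (A : Cantor) (X : Cantor) → HigherCEω A (set X) → ¬ HigherKurtzRandom A X
theorem5p4 em A X X-ce with em {Unbounded (set X)}
-- `X` is constantly `true` on its own set, so `b` is `false`.
... | yes unbounded = constantOn⇒¬higherKurtzRandom em false X-ce unbounded (λ _ → id)
... | no ¬unbounded with ¬∀⟶∃¬ em ¬unbounded
-- All elements of `X` lie below `N`, so `X` is constantly `false` from `N` on.
... | N , N-bounds = constantOn⇒¬higherKurtzRandom em true (atLeast-higherCE A N)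
  (λ p → N ⊔ p , m≤n⊔m N p , m≤m⊔n N p)
  (λ n N≤n → ¬-not λ Xn≡true → N-bounds (n , N≤n , Xn≡true))
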